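{- Let $p$ and $q$ be prime numbers such that $2 < p < q$. Then the Wiener index of the line graph $L(\Gamma(\mathbb{Z}_{pq}))$ is $W(L(\Gamma(\mathbb{Z}_{pq}))) = \dfrac{1}{2}(p-1)(q-1)(2pq-3p-3q+4)$.
   Context: For a positive integer $n$, $\mathbb{Z}_n$ is the ring of residue classes modulo $n$. The zero-divisor graph $\Gamma(\mathbb{Z}_n)$ is the simple undirected graph whose vertices are the nonzero zero-divisors of $\mathbb{Z}_n$ (nonzero $x \in \mathbb{Z}_n$ such that $xy = 0$ for some nonzero $y \in \mathbb{Z}_n$), with distinct vertices $x,y$ adjacent if and only if $xy=0$. The line graph $L(\Gamma(\mathbb{Z}_n))$ is the graph whose vertices are the edges of $\Gamma(\mathbb{Z}_n)$, two distinct vertices being adjacent if the corresponding edges share a common vertex in $\Gamma(\mathbb{Z}_n)$. The Wiener index of a finite connected graph $G$ with vertex set $V$ is $W(G) = \frac{1}{2}\sum_{x,y \in V} d(x,y)$, the sum being over all ordered pairs $(x,y)$, where $d(x,y)$ is the length of a shortest path between $x$ and $y$. -}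

module Defs where

open import Data.Nat.Base using (ℕ; zero; suc; _*_; _≤_; z≤n; s≤s; NonZero)
open import Data.Nat.DivMod using (_mod_)
import Data.Nat.Properties as ℕ
open import Data.Integer.Base using (+_)
open import Data.Rational.Base as ℚ using (ℚ; ½)
open import Data.Fin.Base using (Fin; toℕ; _<_)
open import Data.Fin.Properties using (_≟_; _<?_; any?)
open import Data.List.Base using (List; length; lookup; filter; allFin; cartesianProduct)
open import Data.Vec.Base as Vec using (Vec; []; _∷_)
open import Data.Vec.Relation.Unary.Linked using (Linked; linked?)
open import Data.Vec.Relation.Unary.Unique.Propositional using (Unique)
open import Data.Vec.Relation.Unary.AllPairs using (allPairs?)
open import Data.Product.Base using (Σ-syntax; ∃; ∃-syntax; _×_; _,_; proj₁; proj₂)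
open import Data.Sum.Base using (_⊎_)
open import Function.Base using (_∘_)
open import Level using (0ℓ)
open import Relation.Binary.Core using (Rel)
import Relation.Binary.Definitions as B
open import Relation.Binary.PropositionalEquality.Core using (_≡_; _≢_; refl; sym)
open import Relation.Nullary using (¬_; Dec; yes; no; contradiction)
open import Relation.Nullary.Decidable using (map′; ¬?; _×-dec_; _⊎-dec_)
open import Relation.Unary using (Pred; Decidable)
open import Algebra.Properties.CommutativeMonoid.Sum ℕ.+-0-commutativeMonoid
  using (sum-syntax)

------------------------------------------------------------------------
-- Finite simple graphs

record Graph : Set₁ where
  field
    order      : ℕ
    Adj        : Rel (Fin order) 0ℓ
    adj?       : B.Decidable Adj
    adj-sym    : B.Symmetric Adj
    adj-irrefl : ∀ v → ¬ Adj v v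

  Vertex : Set
  Vertex = Fin order

-- The graph whose vertices are the entries of a list, distinct ones being
-- adjacent when R holds.  Vertices are positions in the list, so the list
-- has to be free of duplicates for positions to stand for elements.
graphOn : {A : Set} (xs : List A) {R : Rel A 0ℓ} →
          B.Decidable R → B.Symmetric R → Graph
graphOn xs {R} R? R-sym = record
  { order      = length xs
  ; Adj        = λ i j → i ≢ j × R (lookup xs i) (lookup xs j)
  ; adj?       = λ i j → ¬? (i ≟ j) ×-dec R? (lookup xs i) (lookup xs j)
  ; adj-sym    = λ (i≢j , r) → i≢j ∘ sym , R-sym r
  ; adj-irrefl = λ v (v≢v , _) → v≢v refl
  }

------------------------------------------------------------------------
-- Line graphs

module _ (G : Graph) where
  open Graph G

  -- Each edge {x , y} is listed once, as the pair with x < y.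
  IsEdge : Pred (Vertex × Vertex) 0ℓ
  IsEdge (x , y) = x < y × Adj x y

  isEdge? : Decidable IsEdge
  isEdge? (x , y) = (x <? y) ×-dec adj? x y

  edges : List (Vertex × Vertex)
  edges = filter isEdge? (cartesianProduct (allFin order) (allFin order))

  EndpointOf : Vertex → Vertex × Vertex → Set
  EndpointOf v (x , y) = v ≡ x ⊎ v ≡ y

  endpointOf? : B.Decidable EndpointOf
  endpointOf? v (x , y) = (v ≟ x) ⊎-dec (v ≟ y)

  ShareVertex : Rel (Vertex × Vertex) 0ℓ
  ShareVertex e f = ∃[ v ] EndpointOf v e × EndpointOf v f

  shareVertex? : B.Decidable ShareVertex
  shareVertex? e f = any? λ v → endpointOf? v e ×-dec endpointOf? v f

  shareVertex-sym : B.Symmetric ShareVertex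
  shareVertex-sym (v , v∈e , v∈f) = v , v∈f , v∈e

  lineGraph : Graph
  lineGraph = graphOn edges shareVertex? shareVertex-sym

------------------------------------------------------------------------
-- Distance and Wiener index

anyVec? : ∀ {n} k {P : Pred (Vec (Fin n) k) 0ℓ} → Decidable P → Dec (∃ P)
anyVec? zero    P? = map′ ([] ,_) (λ { ([] , p) → p }) (P? [])
anyVec? (suc k) P? =
  map′ (λ (x , xs , p) → x ∷ xs , p) (λ { (x ∷ xs , p) → x , xs , p })
       (any? λ x → anyVec? k (P? ∘ (x ∷_)))

least : {P : Pred ℕ 0ℓ} → Decidable P → ∀ k → P k →
        Σ[ m ∈ ℕ ] P m × (∀ j → P j → m ≤ j)
least P? k pk with P? 0
least P? k       pk | yes p₀ = 0 , p₀ , λ _ _ → z≤n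
least P? zero    pk | no ¬p₀ = contradiction pk ¬p₀
least {P} P? (suc k) pk | no ¬p₀ with least (P? ∘ suc) k pk
... | m , pm , m≤ = suc m , pm , below
  where
  below : ∀ j → P j → suc m ≤ j
  below zero    p₀ = contradiction p₀ ¬p₀
  below (suc j) pj = s≤s (m≤ j pj)

module _ (G : Graph) where
  open Graph G

  IsPath : Vertex → Vertex → ∀ {k} → Vec Vertex (suc k) → Set
  IsPath x y vs = Vec.head vs ≡ x × Vec.last vs ≡ y × Linked Adj vs × Unique vs

  isPath? : ∀ x y {k} → Decidable (IsPath x y {k})
  isPath? x y vs = (Vec.head vs ≟ x) ×-dec (Vec.last vs ≟ y) ×-dec
                   linked? adj? vs ×-dec allPairs? (λ u v → ¬? (u ≟ v)) vs

  PathOfLength : Vertex → Vertex → ℕ → Set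
  PathOfLength x y k = ∃ λ (vs : Vec Vertex (suc k)) → IsPath x y vs

  pathOfLength? : ∀ x y → Decidable (PathOfLength x y)
  pathOfLength? x y k = anyVec? (suc k) (isPath? x y)

  Connected : Set
  Connected = ∀ x y → ∃[ k ] PathOfLength x y k

  shortest : Connected → ∀ x y →
             Σ[ d ∈ ℕ ] PathOfLength x y d × (∀ k → PathOfLength x y k → d ≤ k)
  shortest conn x y =
    least (pathOfLength? x y) (proj₁ (conn x y)) (proj₂ (conn x y))

  -- The connectedness witness only bounds the search for a shortest path;
  -- the distance does not depend on it.
  distance : Connected → Vertex → Vertex → ℕ
  distance conn x y = proj₁ (shortest conn x y)

  wienerIndex : Connected → ℚ
  wienerIndex conn =
    ½ ℚ.* (+ (∑[ x < order ] ∑[ y < order ] distance conn x y) ℚ./ 1)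

------------------------------------------------------------------------
-- The zero-divisor graph of ℤ/n, with Fin n as the set of residue classes

module _ {n : ℕ} .{{_ : NonZero n}} where

  0ₙ : Fin n
  0ₙ = 0 mod n

  infixl 7 _·_
  _·_ : Fin n → Fin n → Fin n
  x · y = (toℕ x * toℕ y) mod n

  ·-comm : ∀ x y → x · y ≡ y · x
  ·-comm x y rewrite ℕ.*-comm (toℕ x) (toℕ y) = refl

  NonzeroZeroDivisor : Pred (Fin n) 0ℓ
  NonzeroZeroDivisor x = x ≢ 0ₙ × ∃[ y ] y ≢ 0ₙ × x · y ≡ 0ₙ

  nonzeroZeroDivisor? : Decidable NonzeroZeroDivisor
  nonzeroZeroDivisor? x =
    ¬? (x ≟ 0ₙ) ×-dec any? λ y → ¬? (y ≟ 0ₙ) ×-dec (x · y ≟ 0ₙ)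

  Annihilate : Rel (Fin n) 0ℓ
  Annihilate x y = x · y ≡ 0ₙ

  annihilate-sym : B.Symmetric Annihilate
  annihilate-sym {x} {y} xy≡0 rewrite ·-comm x y = xy≡0

zeroDivisorGraph : (n : ℕ) .{{_ : NonZero n}} → Graph
zeroDivisorGraph n =
  graphOn (filter nonzeroZeroDivisor? (allFin n)) {Annihilate}
          (λ x y → x · y ≟ 0ₙ) (λ {x} {y} → annihilate-sym {x = x} {y})

{-# OPTIONS --safe #-}

-- A nonzero zero divisor modulo pq is a multiple of exactly one of p and q, and
-- two of them annihilate each other exactly when they are of different kinds, so
-- Γ(ℤ/pq) is complete bipartite with parts of sizes p - 1 and q - 1.  Its edges
-- are the cells of a (p - 1) × (q - 1) board, adjacent when in a common row or
-- column, and distance in this rook's graph is Hamming distance.  From any cell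
-- the distances add up to (p - 2)(q - 1) + (p - 1)(q - 2) = 2pq - 3p - 3q + 4.

module Submission where

open import Defs
open import Data.Nat.Base using (ℕ; _<_; _*_)
open import Data.Nat.Properties using (m*n≢0)
open import Data.Nat.Primality using (Prime; prime⇒nonZero)
open import Data.Integer.Base as ℤ using (+_)
open import Data.Rational.Base as ℚ using (½)
open import Data.Product.Base using (Σ-syntax)
open import Relation.Binary.PropositionalEquality.Core using (_≡_)

open import Data.Nat.Base using (zero; suc; _+_; _≤_; z≤n; s≤s; NonZero; ≢-nonZero; ≢-nonZero⁻¹)
open import Data.Nat.Divisibility
  using (_∣_; divides; ∣-trans; ∣-refl; m∣m*n; n∣m*n; >⇒∤; *-pres-∣; m%n≡0⇒n∣m; n∣m⇒m%n≡0)
open import Data.Nat.DivMod using (_mod_; m%n<n)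
open import Data.Nat.Primality using (euclidsLemma; prime⇒irreducible; ¬prime[0]; ¬prime[1])
import Data.Nat.Properties as ℕ
import Data.Integer.Properties as ℤ
open import Data.Integer.Tactic.RingSolver using (solve-∀)
open import Data.Fin.Base as Fin using (Fin; zero; suc; toℕ; fromℕ<; combine; punchIn; _↑ˡ_; _↑ʳ_)
open import Data.Fin.Properties as Fin
  using (_≟_; _<?_; toℕ-fromℕ<; toℕ-injective; toℕ<n; *↔×; punchInᵢ≢i)
open import Data.List.Base using (List; _∷_; length; lookup; filter; allFin; cartesianProduct)
open import Data.List.Membership.Propositional using (_∈_)
open import Data.List.Membership.Propositional.Properties
  using (∈-lookup; ∈-allFin; ∈-filter⁺; ∈-filter⁻; ∈-cartesianProduct⁺)
open import Data.List.Relation.Unary.All as All using ()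
open import Data.List.Relation.Unary.AllPairs using (_∷_)
open import Data.List.Relation.Unary.Any using (index)
open import Data.List.Relation.Unary.Any.Properties using (lookup-index)
open import Data.List.Relation.Unary.Unique.Propositional using (Unique)
open import Data.List.Relation.Unary.Unique.Propositional.Properties
  using (allFin⁺; filter⁺; cartesianProduct⁺)
open import Data.Vec.Base using ([]; _∷_)
open import Data.Vec.Relation.Unary.All using ([]; _∷_)
open import Data.Vec.Relation.Unary.AllPairs using ([]; _∷_)
open import Data.Vec.Relation.Unary.Linked using ([-]; _∷_)
open import Data.Product.Base using (_×_; _,_; proj₁; proj₂; ∃-syntax; map)
open import Data.Sum.Base using (_⊎_; inj₁; inj₂; [_,_]′)
open import Function.Base using (_∘_; id)
open import Function.Bundles using (_↔_; mk⤖; module Inverse)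
open import Function.Consequences.Propositional using (strictlySurjective⇒surjective)
open import Function.Construct.Composition using (_↔-∘_)
open import Function.Definitions using (Injective)
open import Function.Properties.Bijection using (⤖⇒↔)
open import Relation.Binary.PropositionalEquality
  using (_≢_; refl; sym; trans; cong; cong₂; subst; subst₂; ≢-sym; module ≡-Reasoning)
open import Relation.Nullary using (¬_; yes; no; contradiction)
open import Algebra.Properties.CommutativeMonoid.Sum ℕ.+-0-commutativeMonoid
  using (sum; sum-syntax; sum-cong-≗; sum-remove; sum-permute; ∑-distrib-+)

-- Finite sums

∑-const : ∀ n c → ∑[ i < n ] c ≡ n * c
∑-const zero    c = refl
∑-const (suc n) c = cong₂ _+_ (refl {x = c}) (∑-const n c)

∑-↑ : ∀ m {n} (f : Fin (m + n) → ℕ) →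
      ∑[ k < m + n ] f k ≡ ∑[ i < m ] f (i ↑ˡ n) + ∑[ j < n ] f (m ↑ʳ j)
∑-↑ zero    f = refl
∑-↑ (suc m) f = trans (cong₂ _+_ (refl {x = f zero}) (∑-↑ m (f ∘ suc))) (sym (ℕ.+-assoc (f zero) _ _))

∑-combine : ∀ m {n} (f : Fin (m * n) → ℕ) →
            ∑[ k < m * n ] f k ≡ ∑[ i < m ] ∑[ j < n ] f (combine i j)
∑-combine zero        f = refl
∑-combine (suc m) {n} f = trans (∑-↑ n f) (cong₂ _+_ refl (∑-combine m (f ∘ (n ↑ʳ_))))

-- Composing `φ` with the bijection between `Fin (m * n)` and pairs permutes the sum into one over
-- `Fin (m * n)`, which then splits into `m` blocks of length `n`.
∑-reindex : ∀ {m n k} (φ : (Fin m × Fin n) ↔ Fin k) (f : Fin k → ℕ) →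
            ∑[ x < k ] f x ≡ ∑[ i < m ] ∑[ j < n ] f (Inverse.to φ (i , j))
∑-reindex {m} {n} φ f = begin
  sum f                                                     ≡⟨ sum-permute f (φ ↔-∘ *↔× {m} {n}) ⟩
  sum (f ∘ to ∘ Fin.remQuot n)                              ≡⟨ ∑-combine m _ ⟩
  ∑[ i < m ] ∑[ j < n ] f (to (Fin.remQuot n (combine i j)))
    ≡⟨ sum-cong-≗ (λ i → sum-cong-≗ λ j → cong (f ∘ to) (Fin.remQuot-combine i j)) ⟩
  ∑[ i < m ] ∑[ j < n ] f (to (i , j))                      ∎
  where
  open ≡-Reasoning
  open Inverse φ using (to)

-- Hamming distance

δ : ∀ {n} → Fin n → Fin n → ℕ
δ i j with i ≟ j
... | yes _ = 0
... | no  _ = 1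

δ-≡ : ∀ {n} {i j : Fin n} → i ≡ j → δ i j ≡ 0
δ-≡ {i = i} {j} i≡j with i ≟ j
... | yes _  = refl
... | no i≢j = contradiction i≡j i≢j

δ-≢ : ∀ {n} {i j : Fin n} → i ≢ j → δ i j ≡ 1
δ-≢ {i = i} {j} i≢j with i ≟ j
... | yes i≡j = contradiction i≡j i≢j
... | no _    = refl

δ≤1 : ∀ {n} (i j : Fin n) → δ i j ≤ 1
δ≤1 i j with i ≟ j
... | yes _ = z≤n
... | no  _ = s≤s z≤n

-- Only the term at `i` vanishes, and `punchIn i` runs through the `n` other indices, each
-- contributing 1.
∑-δ : ∀ {n} (i : Fin (suc n)) → ∑[ j < suc n ] δ i j ≡ n
∑-δ {n} i = begin
  ∑[ j < suc n ] δ i j                        ≡⟨ sum-remove {i = i} (δ i) ⟩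
  δ i i + ∑[ j < n ] δ i (punchIn i j)
    ≡⟨ cong₂ _+_ (δ-≡ {i = i} refl) (sum-cong-≗ λ j → δ-≢ (punchInᵢ≢i i j ∘ sym)) ⟩
  ∑[ j < n ] 1                                ≡⟨ ∑-const n 1 ⟩
  n * 1                                       ≡⟨ ℕ.*-identityʳ n ⟩
  n                                           ∎
  where open ≡-Reasoning

hamming : ∀ {m n} → Fin m × Fin n → Fin m × Fin n → ℕ
hamming (i , j) (i′ , j′) = δ i i′ + δ j j′

-- The first coordinate of `u` differs from that of the cells in `m` rows of length `suc n`; the
-- second differs in `n` cells of each of the `suc m` rows. The two counts add.
∑-hamming : ∀ {m n} (u : Fin (suc m) × Fin (suc n)) →
            ∑[ i < suc m ] ∑[ j < suc n ] hamming u (i , j) ≡ m * suc n + suc m * n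
∑-hamming {m} {n} (k , l) = begin
  ∑[ i < suc m ] ∑[ j < suc n ] (δ k i + δ l j)
    ≡⟨ sum-cong-≗ (λ i → trans (∑-distrib-+ (λ _ → δ k i) (δ l))
                             (cong₂ _+_ (∑-const (suc n) (δ k i)) (∑-δ l))) ⟩
  ∑[ i < suc m ] (suc n * δ k i + n)
    ≡⟨ ∑-distrib-+ (λ i → suc n * δ k i) (λ _ → n) ⟩
  ∑[ i < suc m ] (suc n * δ k i) + ∑[ i < suc m ] n
    ≡⟨ cong₂ _+_ (∑-*ˡ (suc n) (δ k)) (∑-const (suc m) n) ⟩
  suc n * ∑[ i < suc m ] δ k i + suc m * n
    ≡⟨ cong (λ x → suc n * x + suc m * n) (∑-δ k) ⟩
  suc n * m + suc m * n
    ≡⟨ cong (λ x → x + suc m * n) (ℕ.*-comm (suc n) m) ⟩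
  m * suc n + suc m * n ∎
  where
  open ≡-Reasoning
  ∑-*ˡ : ∀ {r} c (f : Fin r → ℕ) → ∑[ i < r ] (c * f i) ≡ c * ∑[ i < r ] f i
  ∑-*ˡ {zero}  c f = sym (ℕ.*-zeroʳ c)
  ∑-*ˡ {suc r} c f = trans (cong₂ _+_ (refl {x = c * f zero}) (∑-*ˡ c (f ∘ suc)))
                           (sym (ℕ.*-distribˡ-+ c (f zero) _))

-- Rook's graphs

record IsRookGraph (m n : ℕ) (G : Graph) : Set where
  open Graph G
  field
    cells : (Fin m × Fin n) ↔ Vertex

  open Inverse cells public using () renaming (to to cell; from to position)

  row : Vertex → Fin m
  row = proj₁ ∘ position

  col : Vertex → Fin n
  col = proj₂ ∘ position

  field
    adj⁺ : ∀ {x y} → x ≢ y → row x ≡ row y ⊎ col x ≡ col y → Adj x y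
    adj⁻ : ∀ {x y} → Adj x y → row x ≡ row y ⊎ col x ≡ col y

module _ {m n} {G : Graph} (rook : IsRookGraph m n G) where
  open Graph G
  open IsRookGraph rook

  private
    position-cell : ∀ u → position (cell u) ≡ u
    position-cell = Inverse.strictlyInverseʳ cells

    cell-position : ∀ x → cell (position x) ≡ x
    cell-position = Inverse.strictlyInverseˡ cells

  -- A rook corrects one wrong coordinate per move, so the number of moves is the number of
  -- coordinates that differ.
  hammingPath : ∀ x y → PathOfLength G x y (hamming (position x) (position y))
  hammingPath x y with row x ≟ row y | col x ≟ col y
  ... | yes r | yes c = x ∷ [] , refl , x≡y , [-] , [] ∷ []
    where
    x≡y : x ≡ y
    x≡y = trans (sym (cell-position x)) (trans (cong cell (cong₂ _,_ r c)) (cell-position y))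
  ... | yes r | no c = x ∷ y ∷ [] , refl , refl , adj⁺ x≢y (inj₁ r) ∷ [-] , (x≢y ∷ []) ∷ [] ∷ []
    where
    x≢y : x ≢ y
    x≢y = c ∘ cong col
  ... | no r | yes c = x ∷ y ∷ [] , refl , refl , adj⁺ x≢y (inj₂ c) ∷ [-] , (x≢y ∷ []) ∷ [] ∷ []
    where
    x≢y : x ≢ y
    x≢y = r ∘ cong row
  ... | no r | no c =
    x ∷ z ∷ y ∷ [] , refl , refl
    , adj⁺ x≢z (inj₁ (sym row-z)) ∷ adj⁺ z≢y (inj₂ col-z) ∷ [-]
    , (x≢z ∷ r ∘ cong row ∷ []) ∷ (z≢y ∷ []) ∷ [] ∷ []
    where
    z : Vertex
    -- The corner cell: it shares its row with `x` and its column with `y`, so it differs from both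
    -- when neither coordinate agrees.
    z = cell (row x , col y)
    row-z : row z ≡ row x
    row-z = cong proj₁ (position-cell _)
    col-z : col z ≡ col y
    col-z = cong proj₂ (position-cell _)
    x≢z : x ≢ z
    x≢z x≡z = c (trans (cong col x≡z) col-z)
    z≢y : z ≢ y
    z≢y z≡y = r (trans (sym row-z) (cong row z≡y))

  -- A path of length 0 stays in place and a single edge preserves one coordinate. From length 2 on
  -- the bound is automatic, since each of the two coordinates contributes at most 1.
  hamming-minimal : ∀ x y k → PathOfLength G x y k → hamming (position x) (position y) ≤ k
  hamming-minimal x y 0 (_ ∷ [] , refl , refl , _) =
    ℕ.≤-reflexive (cong₂ _+_ (δ-≡ {i = row x} refl) (δ-≡ {i = col x} refl))
  hamming-minimal x y 1 (_ ∷ _ ∷ [] , refl , refl , xy ∷ _ , _) with adj⁻ xy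
  ... | inj₁ r = ℕ.+-mono-≤ (ℕ.≤-reflexive (δ-≡ r)) (δ≤1 (col x) (col y))
  ... | inj₂ c = ℕ.+-mono-≤ (δ≤1 (row x) (row y)) (ℕ.≤-reflexive (δ-≡ c))
  hamming-minimal x y (suc (suc k)) _ =
    ℕ.≤-trans (ℕ.+-mono-≤ (δ≤1 (row x) (row y)) (δ≤1 (col x) (col y))) (s≤s (s≤s z≤n))

  rook-connected : Connected G
  rook-connected x y = _ , hammingPath x y

  distance≡hamming : ∀ conn x y → distance G conn x y ≡ hamming (position x) (position y)
  distance≡hamming conn x y with shortest G conn x y
  ... | d , path , d≤ = ℕ.≤-antisym (d≤ _ (hammingPath x y)) (hamming-minimal x y d path)

-- The sum of distances from a cell is the same number `N` for every cell, so the double sum is `N`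
-- times the number of cells.
∑-distance-rook : ∀ {m n} {G : Graph} → IsRookGraph (suc m) (suc n) G → ∀ conn →
  ∑[ x < Graph.order G ] ∑[ y < Graph.order G ] distance G conn x y
    ≡ suc m * (suc n * (m * suc n + suc m * n))
∑-distance-rook {m} {n} {G} rook conn = begin
  ∑[ x < order ] ∑[ y < order ] distance G conn x y
    ≡⟨ sum-cong-≗ total ⟩
  ∑[ x < order ] N
    ≡⟨ ∑-reindex cells (λ _ → N) ⟩
  ∑[ i < suc m ] ∑[ j < suc n ] N
    ≡⟨ sum-cong-≗ {suc m} (λ _ → ∑-const (suc n) N) ⟩
  ∑[ i < suc m ] (suc n * N)
    ≡⟨ ∑-const (suc m) (suc n * N) ⟩
  suc m * (suc n * N) ∎
  where
  open ≡-Reasoning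
  open Graph G using (order)
  open IsRookGraph rook
  N : ℕ
  N = m * suc n + suc m * n
  total : ∀ x → ∑[ y < order ] distance G conn x y ≡ N
  total x = begin
    ∑[ y < order ] distance G conn x y
      ≡⟨ sum-cong-≗ (distance≡hamming rook conn x) ⟩
    ∑[ y < order ] hamming (position x) (position y)
      ≡⟨ ∑-reindex cells _ ⟩
    ∑[ i < suc m ] ∑[ j < suc n ] hamming (position x) (position (cell (i , j)))
      ≡⟨ sum-cong-≗ (λ i → sum-cong-≗ λ j → cong (hamming (position x)) (Inverse.strictlyInverseʳ cells (i , j))) ⟩
    ∑[ i < suc m ] ∑[ j < suc n ] hamming (position x) (i , j)
      ≡⟨ ∑-hamming (position x) ⟩
    N ∎

-- Positions in duplicate-free lists

lookup-injective : ∀ {A : Set} {xs : List A} → Unique xs → Injective _≡_ _≡_ (lookup xs)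
lookup-injective (_   ∷ _)  {zero}  {zero}  _  = refl
lookup-injective (x∉  ∷ _)  {zero}  {suc j} eq = contradiction eq (All.lookup x∉ (∈-lookup j))
lookup-injective (x∉  ∷ _)  {suc i} {zero}  eq = contradiction (sym eq) (All.lookup x∉ (∈-lookup i))
lookup-injective (_   ∷ u)  {suc i} {suc j} eq = cong suc (lookup-injective u eq)

module _ {A B : Set} {xs : List B} (unique : Unique xs) {f : A → B} (f-inj : Injective _≡_ _≡_ f)
         (f∈ : ∀ a → f a ∈ xs) (f-surj : ∀ {b} → b ∈ xs → ∃[ a ] f a ≡ b) where

  -- Turns a parametrization of the entries into one of the positions, which are the vertices of a
  -- graph built by `graphOn`. Without repetitions an entry determines its position, hence every
  -- position is hit.
  enumeration : A ↔ Fin (length xs)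
  enumeration = ⤖⇒↔ (mk⤖ {to = index ∘ f∈} (injective , strictlySurjective⇒surjective surjective))
    where
    injective : Injective _≡_ _≡_ (index ∘ f∈)
    injective {a} {a′} eq = f-inj (trans (lookup-index (f∈ a))
      (trans (cong (lookup xs) eq) (sym (lookup-index (f∈ a′)))))
    surjective : ∀ i → ∃[ a ] index (f∈ a) ≡ i
    surjective i with f-surj (∈-lookup {xs = xs} i)
    ... | a , eq = a , lookup-injective unique (trans (sym (lookup-index (f∈ a))) eq)

  -- Adjacency in `graphOn` is read off the entries; this lets it be computed from the parameters.
  lookup-enumeration : ∀ a → lookup xs (Inverse.to enumeration a) ≡ f a
  lookup-enumeration a = sym (lookup-index (f∈ a))

-- Line graphs of complete bipartite graphs

record IsCompleteBipartite (m n : ℕ) (G : Graph) : Set where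
  open Graph G
  field
    parts : (Fin m ⊎ Fin n) ↔ Vertex

  left : Fin m → Vertex
  left = Inverse.to parts ∘ inj₁

  right : Fin n → Vertex
  right = Inverse.to parts ∘ inj₂

  field
    adj-across : ∀ i j → Adj (left i) (right j)
    ¬adj-left  : ∀ i i′ → ¬ Adj (left i) (left i′)
    ¬adj-right : ∀ j j′ → ¬ Adj (right j) (right j′)

module _ {m n} {G : Graph} (K : IsCompleteBipartite m n G) where
  open Graph G
  open IsCompleteBipartite K

  private
    parts-injective : Injective _≡_ _≡_ (Inverse.to parts)
    parts-injective {u} {v} eq = trans (sym (Inverse.strictlyInverseʳ parts u))
      (trans (cong (Inverse.from parts) eq) (Inverse.strictlyInverseʳ parts v))

    left-injective : ∀ {i i′} → left i ≡ left i′ → i ≡ i′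
    left-injective eq with parts-injective eq
    ... | refl = refl

    right-injective : ∀ {j j′} → right j ≡ right j′ → j ≡ j′
    right-injective eq with parts-injective eq
    ... | refl = refl

    left≢right : ∀ {i j} → left i ≢ right j
    left≢right eq with parts-injective eq
    ... | ()

    -- `edges` lists each edge with its smaller endpoint first, and the numbering of the vertices
    -- need not place the left part before the right one.
    sorted : Vertex → Vertex → Vertex × Vertex
    sorted u v with u <? v
    ... | yes _ = u , v
    ... | no  _ = v , u

    sorted-≡ : ∀ {u v} → u Fin.< v → sorted u v ≡ (u , v)
    sorted-≡ {u} {v} u<v with u <? v
    ... | yes _  = refl
    ... | no u≮v = contradiction u<v u≮v

    sorted-≡′ : ∀ {u v} → v Fin.< u → sorted u v ≡ (v , u)
    sorted-≡′ {u} {v} v<u with u <? v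
    ... | yes u<v = contradiction v<u (Fin.<-asym {x = u} {v} u<v)
    ... | no _    = refl

    edge : Fin m × Fin n → Vertex × Vertex
    edge (i , j) = sorted (left i) (right j)

    left-endpoint : ∀ c → EndpointOf G (left (proj₁ c)) (edge c)
    left-endpoint (i , j) with left i <? right j
    ... | yes _ = inj₁ refl
    ... | no  _ = inj₂ refl

    right-endpoint : ∀ c → EndpointOf G (right (proj₂ c)) (edge c)
    right-endpoint (i , j) with left i <? right j
    ... | yes _ = inj₂ refl
    ... | no  _ = inj₁ refl

    endpoint-edge : ∀ c {v} → EndpointOf G v (edge c) → v ≡ left (proj₁ c) ⊎ v ≡ right (proj₂ c)
    endpoint-edge (i , j) e with left i <? right j | e
    ... | yes _ | inj₁ eq = inj₁ eq
    ... | yes _ | inj₂ eq = inj₂ eq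
    ... | no  _ | inj₁ eq = inj₂ eq
    ... | no  _ | inj₂ eq = inj₁ eq

    left-shared : ∀ {i} c′ → EndpointOf G (left i) (edge c′) → i ≡ proj₁ c′
    left-shared c′ e with endpoint-edge c′ e
    ... | inj₁ eq = left-injective eq
    ... | inj₂ eq = contradiction eq left≢right

    right-shared : ∀ {j} c′ → EndpointOf G (right j) (edge c′) → j ≡ proj₂ c′
    right-shared c′ e with endpoint-edge c′ e
    ... | inj₁ eq = contradiction (sym eq) left≢right
    ... | inj₂ eq = right-injective eq

    -- The parts are disjoint, so the left endpoint of one edge can only be the left endpoint of an
    -- equal edge, and likewise on the right. Both coordinates are thus recovered.
    edge-injective : Injective _≡_ _≡_ edge
    edge-injective {c} {c′} eq = cong₂ _,_
      (left-shared c′ (subst (EndpointOf G _) eq (left-endpoint c)))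
      (right-shared c′ (subst (EndpointOf G _) eq (right-endpoint c)))

    aligned⇒share : ∀ c c′ → proj₁ c ≡ proj₁ c′ ⊎ proj₂ c ≡ proj₂ c′ → ShareVertex G (edge c) (edge c′)
    aligned⇒share c c′ (inj₁ refl) = _ , left-endpoint c , left-endpoint c′
    aligned⇒share c c′ (inj₂ refl) = _ , right-endpoint c , right-endpoint c′

    share⇒aligned : ∀ c c′ → ShareVertex G (edge c) (edge c′) → proj₁ c ≡ proj₁ c′ ⊎ proj₂ c ≡ proj₂ c′
    share⇒aligned c c′ (v , v∈c , v∈c′) with endpoint-edge c v∈c
    ... | inj₁ refl = inj₁ (left-shared c′ v∈c′)
    ... | inj₂ refl = inj₂ (right-shared c′ v∈c′)

    edge-isEdge : ∀ c → IsEdge G (edge c)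
    edge-isEdge (i , j) with left i <? right j
    ... | yes l<r = l<r , adj-across i j
    -- Failure of `<` gives the reverse order only weakly; it is strict because a left and a right
    -- vertex are distinct.
    ... | no l≮r  = ℕ.≤∧≢⇒< (ℕ.≮⇒≥ l≮r) (left≢right ∘ sym ∘ toℕ-injective) , adj-sym (adj-across i j)

    edge∈ : ∀ c → edge c ∈ edges G
    edge∈ c = ∈-filter⁺ (isEdge? G) (∈-cartesianProduct⁺ (∈-allFin _) (∈-allFin _)) (edge-isEdge c)

    isEdge-edge : ∀ u v → IsEdge G (Inverse.to parts u , Inverse.to parts v) →
                  ∃[ c ] edge c ≡ (Inverse.to parts u , Inverse.to parts v)
    isEdge-edge (inj₁ i) (inj₁ i′) (_ , a)   = contradiction a (¬adj-left i i′)
    isEdge-edge (inj₁ i) (inj₂ j)  (u<v , _) = (i , j) , sorted-≡ u<v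
    isEdge-edge (inj₂ j) (inj₁ i)  (u<v , _) = (i , j) , sorted-≡′ u<v
    isEdge-edge (inj₂ j) (inj₂ j′) (_ , a)   = contradiction a (¬adj-right j j′)

    edge-surjective : ∀ {e} → e ∈ edges G → ∃[ c ] edge c ≡ e
    edge-surjective {x , y} e∈ =
      -- Replacing `x` and `y` by images under `parts` shows on which side each lies, which is what
      -- `isEdge-edge` splits on.
      subst₂ (λ u v → IsEdge G (u , v) → ∃[ c ] edge c ≡ (u , v))
        (Inverse.strictlyInverseˡ parts x) (Inverse.strictlyInverseˡ parts y)
        (isEdge-edge (Inverse.from parts x) (Inverse.from parts y))
        (proj₂ (∈-filter⁻ (isEdge? G) {xs = cartesianProduct (allFin order) (allFin order)} e∈))

    edges-unique : Unique (edges G)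
    edges-unique = filter⁺ (isEdge? G) (cartesianProduct⁺ (allFin⁺ order) (allFin⁺ order))

  -- The row of an edge is its left endpoint and its column is its right endpoint; two edges meet
  -- exactly when one of these agrees.
  lineGraph-rook : IsRookGraph m n (lineGraph G)
  lineGraph-rook = record
    { cells = cells
    ; adj⁺  = λ {x} {y} x≢y aligned → x≢y ,
        subst₂ (ShareVertex G) (sym (lookup-edges x)) (sym (lookup-edges y)) (aligned⇒share _ _ aligned)
    ; adj⁻  = λ {x} {y} (_ , share) →
        share⇒aligned _ _ (subst₂ (ShareVertex G) (lookup-edges x) (lookup-edges y) share)
    }
    where
    cells : (Fin m × Fin n) ↔ Fin (length (edges G))
    cells = enumeration edges-unique edge-injective edge∈ edge-surjective

    position : Fin (length (edges G)) → Fin m × Fin n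
    position = Inverse.from cells

    lookup-edges : ∀ x → lookup (edges G) x ≡ edge (position x)
    lookup-edges x = trans (cong (lookup (edges G)) (sym (Inverse.strictlyInverseˡ cells x)))
      (lookup-enumeration edges-unique edge-injective edge∈ edge-surjective (position x))

-- Zero divisors modulo a product of two primes

module _ {n : ℕ} .{{_ : NonZero n}} where

  mod≡0⁺ : ∀ {k} → n ∣ k → k mod n ≡ 0ₙ
  mod≡0⁺ {k} n∣k = toℕ-injective (trans (toℕ-fromℕ< (m%n<n k n))
    (trans (trans (n∣m⇒m%n≡0 k n n∣k) (sym (n∣m⇒m%n≡0 0 n (divides 0 refl)))) (sym (toℕ-fromℕ< (m%n<n 0 n)))))

  toℕ-0ₙ : toℕ (0ₙ {n}) ≡ 0
  toℕ-0ₙ = trans (toℕ-fromℕ< (m%n<n 0 n)) (n∣m⇒m%n≡0 0 n (divides 0 refl))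

  mod≡0⁻ : ∀ {k} → k mod n ≡ 0ₙ → n ∣ k
  mod≡0⁻ {k} eq = m%n≡0⇒n∣m k n (trans (sym (toℕ-fromℕ< (m%n<n k n))) (trans (cong toℕ eq) toℕ-0ₙ))

  ≢0⁺ : ∀ {x : Fin n} → toℕ x ≢ 0 → x ≢ 0ₙ
  ≢0⁺ x≢0 refl = x≢0 toℕ-0ₙ

  ≢0⁻ : ∀ {x : Fin n} → x ≢ 0ₙ → toℕ x ≢ 0
  ≢0⁻ x≢0 eq = x≢0 (toℕ-injective (trans eq (sym toℕ-0ₙ)))

module _ {m n : ℕ} (d : ℕ) .{{_ : NonZero d}} .{{_ : NonZero n}} (md≡n : suc m * d ≡ n) where

  private
    multiple<n : (i : Fin m) → suc (toℕ i) * d < n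
    multiple<n i = subst (_ <_) md≡n (ℕ.*-monoˡ-< d (s≤s (toℕ<n i)))

  -- The shift by one leaves out 0, so the `m` indices give the nonzero multiples of `d` below
  -- `n = suc m * d`.
  multiple : Fin m → Fin n
  multiple i = fromℕ< (multiple<n i)

  toℕ-multiple : ∀ i → toℕ (multiple i) ≡ suc (toℕ i) * d
  toℕ-multiple i = toℕ-fromℕ< (multiple<n i)

  multiple-injective : ∀ {i j} → multiple i ≡ multiple j → i ≡ j
  multiple-injective {i} {j} eq = toℕ-injective (ℕ.suc-injective (ℕ.*-cancelʳ-≡ _ _ d
    (trans (sym (toℕ-multiple i)) (trans (cong toℕ eq) (toℕ-multiple j)))))

  multiple-≢0 : ∀ i → toℕ (multiple i) ≢ 0
  multiple-≢0 i eq = ≢-nonZero⁻¹ (suc (toℕ i) * d) {{m*n≢0 (suc (toℕ i)) d}} (trans (sym (toℕ-multiple i)) eq)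

  -- A zero quotient would make `x` zero; a quotient `suc k` belongs to the index `k`.
  multiple-surjective : ∀ {x : Fin n} → toℕ x ≢ 0 → d ∣ toℕ x → ∃[ i ] multiple i ≡ x
  multiple-surjective x≢0 (divides zero eq) = contradiction eq x≢0
  multiple-surjective {x} x≢0 (divides (suc k) eq) = fromℕ< k<m ,
    toℕ-injective (trans (toℕ-multiple (fromℕ< k<m)) (trans (cong (λ l → suc l * d) (toℕ-fromℕ< k<m)) (sym eq)))
    where
    k<m : k < m
    -- The bound `toℕ x < n` reads `suc k * d < suc m * d`, and `d` cancels.
    k<m = ℕ.≤-pred (ℕ.*-cancelʳ-< d (suc k) (suc m) (subst₂ _<_ eq (sym md≡n) (toℕ<n x)))

  module _ (prime : Prime (suc m)) (∤d : ¬ suc m ∣ d) where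

    -- By Euclid's lemma the prime would divide `d` or the factor `suc (toℕ i)`, which is positive
    -- and smaller than the prime.
    ∤-multiple : ∀ i → ¬ suc m ∣ toℕ (multiple i)
    ∤-multiple i p∣ with euclidsLemma (suc (toℕ i)) d prime (subst (suc m ∣_) (toℕ-multiple i) p∣)
    ... | inj₁ p∣i = >⇒∤ (s≤s (toℕ<n i)) p∣i
    ... | inj₂ p∣d = ∤d p∣d

    -- The prime divides the modulus, so a vanishing product would make it divide one of the two
    -- multiples.
    ¬annihilate-multiples : ∀ i j → ¬ Annihilate (multiple i) (multiple j)
    ¬annihilate-multiples i j eq
      with euclidsLemma (toℕ (multiple i)) (toℕ (multiple j)) prime
             (∣-trans (subst (suc m ∣_) md≡n (m∣m*n d)) (mod≡0⁻ eq))
    ... | inj₁ p∣ = ∤-multiple i p∣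
    ... | inj₂ p∣ = ∤-multiple j p∣

prime-∤-prime : ∀ {p q} → Prime p → Prime q → p ≢ q → ¬ p ∣ q
prime-∤-prime p-prime q-prime p≢q p∣q with prime⇒irreducible q-prime p∣q
... | inj₁ refl = ¬prime[1] p-prime
... | inj₂ p≡q  = p≢q p≡q

-- Write `k = l * p`. Since `q` cannot divide the other prime `p`, it divides `l`.
distinct-primes-∣ : ∀ {p q k} → Prime p → Prime q → p ≢ q → p ∣ k → q ∣ k → p * q ∣ k
distinct-primes-∣ {p} {q} p-prime q-prime p≢q (divides l refl) q∣k
  with euclidsLemma l p q-prime q∣k
... | inj₁ q∣l = subst (_∣ l * p) (ℕ.*-comm q p) (*-pres-∣ q∣l ∣-refl)
... | inj₂ q∣p = contradiction q∣p (prime-∤-prime q-prime p-prime (≢-sym p≢q))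

-- The modulus is a variable N because p * q, with p = 2 + m, would unfold.
module _ {m n N : ℕ} .{{_ : NonZero N}} (p-prime : Prime (2 + m)) (q-prime : Prime (2 + n))
         (p≢q : 2 + m ≢ 2 + n) (pq≡N : (2 + m) * (2 + n) ≡ N) where

  private
    p q : ℕ
    p = 2 + m
    q = 2 + n

    qp≡N : q * p ≡ N
    qp≡N = trans (ℕ.*-comm q p) pq≡N

    p∣N : p ∣ N
    p∣N = subst (p ∣_) pq≡N (m∣m*n q)

    q∣N : q ∣ N
    q∣N = subst (q ∣_) pq≡N (n∣m*n p)

    -- The sizes cross over: there are `p - 1 = suc m` nonzero multiples of `q`, and `q - 1 = suc n`
    -- of `p`.
    multipleOfQ : Fin (suc m) → Fin N
    multipleOfQ = multiple q pq≡N

    multipleOfP : Fin (suc n) → Fin N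
    multipleOfP = multiple p qp≡N

    p∤q : ¬ p ∣ q
    p∤q = prime-∤-prime p-prime q-prime p≢q

    q∤p : ¬ q ∣ p
    q∤p = prime-∤-prime q-prime p-prime (≢-sym p≢q)

    P∣ : ∀ j → p ∣ toℕ (multipleOfP j)
    P∣ j = subst (p ∣_) (sym (toℕ-multiple p qp≡N j)) (n∣m*n (suc (toℕ j)))

    Q∣ : ∀ i → q ∣ toℕ (multipleOfQ i)
    Q∣ i = subst (q ∣_) (sym (toℕ-multiple q pq≡N i)) (n∣m*n (suc (toℕ i)))

    Q≢P : ∀ i j → multipleOfQ i ≢ multipleOfP j
    Q≢P i j eq = ∤-multiple q pq≡N p-prime p∤q i (subst (λ x → p ∣ toℕ x) (sym eq) (P∣ j))

    annihilate : ∀ i j → Annihilate (multipleOfQ i) (multipleOfP j)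
    annihilate i j = mod≡0⁺ (subst (_∣ toℕ (multipleOfQ i) * toℕ (multipleOfP j)) qp≡N (*-pres-∣ (Q∣ i) (P∣ j)))

    multipleOf : Fin (suc m) ⊎ Fin (suc n) → Fin N
    multipleOf = [ multipleOfQ , multipleOfP ]′

    multipleOf-injective : Injective _≡_ _≡_ multipleOf
    multipleOf-injective {inj₁ i} {inj₁ i′} eq = cong inj₁ (multiple-injective q pq≡N eq)
    multipleOf-injective {inj₁ i} {inj₂ j}  eq = contradiction eq (Q≢P i j)
    multipleOf-injective {inj₂ j} {inj₁ i}  eq = contradiction (sym eq) (Q≢P i j)
    multipleOf-injective {inj₂ j} {inj₂ j′} eq = cong inj₂ (multiple-injective p qp≡N eq)

    zeroDivisors : List (Fin N)
    zeroDivisors = filter nonzeroZeroDivisor? (allFin N)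

    multipleOf-zeroDivisor : ∀ u → NonzeroZeroDivisor (multipleOf u)
    -- The index `zero` yields the prime itself, so multiples of `q` are killed by `p` and, in the
    -- next clause, multiples of `p` by `q`.
    multipleOf-zeroDivisor (inj₁ i) = ≢0⁺ (multiple-≢0 q pq≡N i) , multipleOfP zero
      , ≢0⁺ (multiple-≢0 {suc n} p qp≡N zero) , annihilate i zero
    multipleOf-zeroDivisor (inj₂ j) = ≢0⁺ (multiple-≢0 p qp≡N j) , multipleOfQ zero
      , ≢0⁺ (multiple-≢0 {suc m} q pq≡N zero)
      , annihilate-sym {x = multipleOfQ zero} {multipleOfP j} (annihilate zero j)

    multipleOf-∈ : ∀ u → multipleOf u ∈ zeroDivisors
    multipleOf-∈ u = ∈-filter⁺ nonzeroZeroDivisor? (∈-allFin _) (multipleOf-zeroDivisor u)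

    -- If neither prime divided `x`, both would divide its annihilator `y`; then `pq` would divide
    -- `y`, although `y` is nonzero and below `pq`.
    zeroDivisor-∣ : ∀ {x} → NonzeroZeroDivisor x → p ∣ toℕ x ⊎ q ∣ toℕ x
    zeroDivisor-∣ {x} (x≢0 , y , y≢0 , xy≡0)
      with euclidsLemma (toℕ x) (toℕ y) p-prime (∣-trans p∣N (mod≡0⁻ xy≡0))
         | euclidsLemma (toℕ x) (toℕ y) q-prime (∣-trans q∣N (mod≡0⁻ xy≡0))
    ... | inj₁ p∣x | _        = inj₁ p∣x
    ... | _        | inj₁ q∣x = inj₂ q∣x
    ... | inj₂ p∣y | inj₂ q∣y = contradiction
      (subst (_∣ toℕ y) pq≡N (distinct-primes-∣ p-prime q-prime p≢q p∣y q∣y))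
      (>⇒∤ {{≢-nonZero (≢0⁻ y≢0)}} (toℕ<n y))

    multipleOf-surjective : ∀ {x} → x ∈ zeroDivisors → ∃[ u ] multipleOf u ≡ x
    multipleOf-surjective {x} x∈
      with zd@(x≢0 , _) ← proj₂ (∈-filter⁻ nonzeroZeroDivisor? {xs = allFin N} x∈)
      with zeroDivisor-∣ zd
    ... | inj₁ p∣x = map inj₂ id (multiple-surjective {suc n} p qp≡N (≢0⁻ x≢0) p∣x)
    ... | inj₂ q∣x = map inj₁ id (multiple-surjective {suc m} q pq≡N (≢0⁻ x≢0) q∣x)

    zeroDivisors-unique : Unique zeroDivisors
    zeroDivisors-unique = filter⁺ nonzeroZeroDivisor? (allFin⁺ N)

    vertices : (Fin (suc m) ⊎ Fin (suc n)) ↔ Fin (length zeroDivisors)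
    vertices = enumeration zeroDivisors-unique multipleOf-injective multipleOf-∈ multipleOf-surjective

    lookup-vertices : ∀ u → lookup zeroDivisors (Inverse.to vertices u) ≡ multipleOf u
    lookup-vertices =
      lookup-enumeration zeroDivisors-unique multipleOf-injective multipleOf-∈ multipleOf-surjective

  zeroDivisorGraph-completeBipartite : IsCompleteBipartite (suc m) (suc n) (zeroDivisorGraph N)
  zeroDivisorGraph-completeBipartite = record
    { parts      = vertices
    ; adj-across = λ i j →
        (λ eq → Q≢P i j (trans (sym (lookup-vertices (inj₁ i)))
                      (trans (cong (lookup zeroDivisors) eq) (lookup-vertices (inj₂ j)))))
      , subst₂ Annihilate (sym (lookup-vertices (inj₁ i))) (sym (lookup-vertices (inj₂ j))) (annihilate i j)
    ; ¬adj-left  = λ i i′ (_ , a) → ¬annihilate-multiples q pq≡N p-prime p∤q i i′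
        (subst₂ Annihilate (lookup-vertices (inj₁ i)) (lookup-vertices (inj₁ i′)) a)
    ; ¬adj-right = λ j j′ (_ , a) → ¬annihilate-multiples p qp≡N q-prime q∤p j j′
        (subst₂ Annihilate (lookup-vertices (inj₂ j)) (lookup-vertices (inj₂ j′)) a)
    }

-- The closed form and the Wiener index

-- With `p = 2 + m` and `q = 2 + n` the left side involves no subtraction. It can therefore be
-- carried from the naturals to the integers term by term, leaving a polynomial identity in `m` and
-- `n`.
closedForm : ∀ m n → let P = + (2 + m) ; Q = + (2 + n) in
  + (suc m * (suc n * (m * suc n + suc m * n)))
    ≡ (P ℤ.- + 1) ℤ.* (Q ℤ.- + 1) ℤ.* (+ 2 ℤ.* P ℤ.* Q ℤ.- + 3 ℤ.* P ℤ.- + 3 ℤ.* Q ℤ.+ + 4)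
closedForm m n = trans push (polynomial (+ m) (+ n))
  where
  M M⁺ N N⁺ : ℤ.ℤ
  M  = + m
  M⁺ = + 1 ℤ.+ + m
  N  = + n
  N⁺ = + 1 ℤ.+ + n
  push : + (suc m * (suc n * (m * suc n + suc m * n))) ≡ M⁺ ℤ.* (N⁺ ℤ.* (M ℤ.* N⁺ ℤ.+ M⁺ ℤ.* N))
  push = trans (ℤ.pos-* (suc m) _) (cong (M⁺ ℤ.*_)
    (trans (ℤ.pos-* (suc n) _) (cong (N⁺ ℤ.*_) (cong₂ ℤ._+_ (ℤ.pos-* m (suc n)) (ℤ.pos-* (suc m) n)))))
  polynomial : ∀ x y →
    (+ 1 ℤ.+ x) ℤ.* ((+ 1 ℤ.+ y) ℤ.* (x ℤ.* (+ 1 ℤ.+ y) ℤ.+ (+ 1 ℤ.+ x) ℤ.* y))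
      ≡ (+ 2 ℤ.+ x ℤ.- + 1) ℤ.* (+ 2 ℤ.+ y ℤ.- + 1)
          ℤ.* (+ 2 ℤ.* (+ 2 ℤ.+ x) ℤ.* (+ 2 ℤ.+ y) ℤ.- + 3 ℤ.* (+ 2 ℤ.+ x) ℤ.- + 3 ℤ.* (+ 2 ℤ.+ y) ℤ.+ + 4)
  polynomial = solve-∀

wienerIndex-rook : ∀ {m n} {G : Graph} → IsRookGraph (suc m) (suc n) G →
  Σ[ conn ∈ Connected G ]
    wienerIndex G conn ≡ ½ ℚ.* (+ (suc m * (suc n * (m * suc n + suc m * n))) ℚ./ 1)
wienerIndex-rook rook = rook-connected rook ,
  cong (λ s → ½ ℚ.* (+ s ℚ./ 1)) (∑-distance-rook rook (rook-connected rook))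

-- The case split puts the primes in the form `2 + m` and `2 + n`, while the separate modulus `N`
-- keeps the graph untouched by it.
wienerIndex-lineGraph : ∀ {p q N} .{{_ : NonZero N}} → Prime p → Prime q → p ≢ q → p * q ≡ N →
  let L = lineGraph (zeroDivisorGraph N)
      P = + p
      Q = + q
  in Σ[ conn ∈ Connected L ]
       wienerIndex L conn
         ≡ ½ ℚ.* (((P ℤ.- + 1) ℤ.* (Q ℤ.- + 1)
                     ℤ.* (+ 2 ℤ.* P ℤ.* Q ℤ.- + 3 ℤ.* P ℤ.- + 3 ℤ.* Q ℤ.+ + 4)) ℚ./ 1)
wienerIndex-lineGraph {zero}        {_}           p-prime _       = contradiction p-prime ¬prime[0]
wienerIndex-lineGraph {suc zero}    {_}           p-prime _       = contradiction p-prime ¬prime[1]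
wienerIndex-lineGraph {suc (suc _)} {zero}        _       q-prime = contradiction q-prime ¬prime[0]
wienerIndex-lineGraph {suc (suc _)} {suc zero}    _       q-prime = contradiction q-prime ¬prime[1]
wienerIndex-lineGraph {suc (suc m)} {suc (suc n)} p-prime q-prime p≢q pq≡N =
  map id (λ eq → trans eq (cong (λ z → ½ ℚ.* (z ℚ./ 1)) (closedForm m n)))
    (wienerIndex-rook (lineGraph-rook (zeroDivisorGraph-completeBipartite p-prime q-prime p≢q pq≡N)))

theorem3p7 : (p q : ℕ) (p-prime : Prime p) (q-prime : Prime q) → 2 < p → p < q →
  let instance pq≢0 = m*n≢0 p q {{prime⇒nonZero p-prime}} {{prime⇒nonZero q-prime}}
      L = lineGraph (zeroDivisorGraph (p * q))
      P = + p
      Q = + q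
  in Σ[ conn ∈ Connected L ]
       wienerIndex L conn
         ≡ ½ ℚ.* (((P ℤ.- + 1) ℤ.* (Q ℤ.- + 1)
                     ℤ.* (+ 2 ℤ.* P ℤ.* Q ℤ.- + 3 ℤ.* P ℤ.- + 3 ℤ.* Q ℤ.+ + 4)) ℚ./ 1)
theorem3p7 p q p-prime q-prime _ p<q =
  wienerIndex-lineGraph {{m*n≢0 p q {{prime⇒nonZero p-prime}} {{prime⇒nonZero q-prime}}}}
    -- The order of the primes enters as their distinctness, and `refl` fixes the modulus as
    -- `p * q`.
    p-prime q-prime (ℕ.<⇒≢ p<q) refl
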